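{- For any forest $F$ of order $n\geq 3$ and integer $k$, $\operatorname{nc}(F,k)\leq \left\lfloor\frac{7}{3}k\right\rfloor$, and the bound is tight, even for caterpillars of maximum degree $3$ (which have pathwidth $1$).
   Context: For a vertex $v$ of a graph $G$, $N[v]$ denotes the closed neighbourhood of $v$, i.e. the set of vertices of $G$ at distance at most $1$ from $v$. For a graph $G=(V,E)$ and a set $S\subseteq V$, the neighbourhood complexity of $S$ is $\operatorname{nc}(G,S)=|\{N[u]\cap S : u\in V\}|$, the number of distinct intersections of closed neighbourhoods of vertices of $G$ with $S$ (the empty intersection is counted if it occurs). For an integer $k$, $\operatorname{nc}(G,k)=\max_{S\subseteq V,\ |S|=k}\operatorname{nc}(G,S)$. A caterpillar is a tree in which all vertices of degree at least $2$ lie on a single path. The pathwidth of a graph is the minimum, over all its path-decompositions (tree-decompositions whose tree is a path), of the maximum bag size minus $1$.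
   Formalization: The integer k is required to be at least 1: for k = 0 the only intersection is the empty one, so nc(F,0) = 1 exceeds 0 and the stated bound fails; for negative k, nc(F,k) is undefined. -}

module Defs where

open import Level using (0ℓ)
import Data.Bool.Properties as Bool
open import Data.Fin using (Fin) renaming (_≤_ to _≤ᶠ_)
open import Data.Fin.Subset using (Subset; inside; outside; ⁅_⁆; _∪_; _∩_; _∈_; ∣_∣)
open import Data.List using (List; []; _∷_; _++_; _∷ʳ_; map; filter; length; allFin; deduplicate)
import Data.List as List
open import Data.List.Extrema.Nat using (max)
import Data.List.Membership.Propositional as List
open import Data.List.Relation.Unary.Linked using (Linked)
open import Data.List.Relation.Unary.Unique.Propositional using (Unique)
open import Data.Nat using (ℕ; zero; suc; _∸_; _≤_; _≟_)
open import Data.Product using (_×_; Σ-syntax; ∃-syntax)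
import Data.Vec as Vec
open import Data.Vec.Properties using (≡-dec)
open import Relation.Binary.Construct.Closure.ReflexiveTransitive using (Star)
open import Relation.Binary.Core using (Rel)
open import Relation.Binary.Definitions using (Decidable; DecidableEquality; Irreflexive; Symmetric)
open import Relation.Binary.PropositionalEquality using (_≡_; _≢_)
open import Relation.Nullary using (¬_; does)

-- Finite simple graphs of order n.
record Graph (n : ℕ) : Set₁ where
  field
    Adj    : Rel (Fin n) 0ℓ
    adj?   : Decidable Adj
    sym    : Symmetric Adj
    irrefl : Irreflexive _≡_ Adj

_≟ˢ_ : ∀ {n} → DecidableEquality (Subset n)
_≟ˢ_ = ≡-dec Bool._≟_

subsets : ∀ n → List (Subset n)
subsets zero    = Vec.[] ∷ []
subsets (suc n) = map (inside Vec.∷_) (subsets n) ++ map (outside Vec.∷_) (subsets n)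

module _ {n : ℕ} (G : Graph n) where
  open Graph G

  N⟨_⟩ : Fin n → Subset n
  N⟨ v ⟩ = Vec.tabulate (λ u → does (adj? v u))

  N[_] : Fin n → Subset n
  N[ v ] = ⁅ v ⁆ ∪ N⟨ v ⟩

  degree : Fin n → ℕ
  degree v = ∣ N⟨ v ⟩ ∣

  maxDegree : ℕ
  maxDegree = max 0 (map degree (allFin n))

  ncSet : Subset n → ℕ
  ncSet S = length (deduplicate _≟ˢ_ (map (λ u → N[ u ] ∩ S) (allFin n)))

  -- For k > n there is no S with ∣ S ∣ ≡ k, and the value is 0.
  nc : ℕ → ℕ
  nc k = max 0 (map ncSet (filter (λ S → ∣ S ∣ ≟ k) (subsets n)))

  IsPath : List (Fin n) → Set
  IsPath vs = Linked Adj vs × Unique vs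

  -- A cycle is a path u, vs, w on at least three vertices, closed by the edge wu.
  record Cycle : Set where
    field
      u w    : Fin n
      vs     : List (Fin n)
      vs≢[]  : vs ≢ []
      isPath : IsPath (u ∷ (vs ∷ʳ w))
      closed : Adj w u

  Forest : Set
  Forest = ¬ Cycle

  -- The component Fin n says that the graph is nonempty.
  Connected : Set
  Connected = Fin n × (∀ u v → Star Adj u v)

  Tree : Set
  Tree = Connected × Forest

  Caterpillar : Set
  Caterpillar = Tree × ∃[ p ] (IsPath p × (∀ v → 2 ≤ degree v → v List.∈ p))

  -- A tree-decomposition over the path 0 – 1 – ⋯ – (m − 1); the indices of the bags
  -- containing a given vertex induce a subpath exactly when they form an interval.
  record PathDecomposition : Set where
    field
      m           : ℕ
      bag         : Fin m → Subset n
      vertexCover : ∀ v → ∃[ i ] v ∈ bag i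
      edgeCover   : ∀ {u v} → Adj u v → ∃[ i ] (u ∈ bag i × v ∈ bag i)
      interval    : ∀ {v i j k} → i ≤ᶠ j → j ≤ᶠ k → v ∈ bag i → v ∈ bag k → v ∈ bag j

    width : ℕ
    width = max 0 (List.tabulate (λ i → ∣ bag i ∣)) ∸ 1

  HasPathwidth : ℕ → Set
  HasPathwidth w = (Σ[ D ∈ PathDecomposition ] PathDecomposition.width D ≡ w)
                 × (∀ (D : PathDecomposition) → w ≤ PathDecomposition.width D)

{-# OPTIONS --safe #-}

-- Upper bound.  Within S, let A be the vertices with at most one neighbour in S, B the other
-- ones, and let M be the vertices outside S with at least two neighbours in S.  Every class
-- N[u] ∩ S is empty, a singleton, the class of a vertex of M or of B, or an edge meeting A, so
--   nc ≤ 1 + k + |M| + |B| + e(A) + e(A,B).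
-- A forest on A ∪ B ∪ M has fewer edges than vertices, hence
--   1 + |M| + e(A) + e(A,B) + e(B) ≤ k,
-- and degree counts give 2|B| ≤ e(A,B) + 2 e(B) ≤ |A| + 2 e(B).  Together, 3 nc ≤ 7k.
--
-- Tightness.  In a comb (a path with one pendant vertex at each of its vertices), each block SSSx
-- of consecutive path vertices gives seven classes: three singletons from the pendant vertices,
-- three from the S-vertices, and one from x, which sees the last S of its block and the first of
-- the next one.
--
-- Pathwidth.  Sweep along the central path of the caterpillar: consecutive path vertices occupy
-- consecutive intervals that share an endpoint, and each other vertex occupies one interior point
-- of the interval of its neighbour.  No point lies in more than two of these intervals.
module Submission where

open import Defs
open import Data.Bool using (Bool; true; false; _∨_; T)
open import Data.Bool.Properties using (T?; ∨-comm; ∧-zeroʳ)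
open import Data.Empty using (⊥; ⊥-elim)
open import Data.Fin using (Fin; zero; suc; toℕ; fromℕ<; combine; _↑ʳ_)
import Data.Fin as Fin
open import Data.Fin.Patterns
open import Data.Fin.Properties
  using (toℕ-combine; combine-injective; toℕ-injective; toℕ-fromℕ<; toℕ<n)
import Data.Fin.Subset as Sub
open import Data.Fin.Subset using (Subset; inside; outside; ⁅_⁆; _∪_; _∩_; ∣_∣) renaming (_∈_ to _∈ˢ_)
open import Data.Fin.Subset.Properties
  using (_∈?_; x∈⁅x⁆; x∈⁅y⁆⇒x≡y; ⊆-antisym; ∉⊥; x∈p∩q⁺; x∈p∩q⁻; x∈p∪q⁺; x∈p∪q⁻; ∪-comm)
open import Data.List
  using (List; []; _∷_; _++_; _∷ʳ_; [_]; map; filter; length; lookup; tabulate; allFin; deduplicate)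
open import Data.List.Extrema.Nat using (max≤v⁺; xs≤max)
import Data.List.Membership.DecPropositional as DecMembership
open import Data.List.Membership.Propositional using (_∈_; _∉_; find)
open import Data.List.Membership.Propositional.Properties
  using (∈-∃++; ∈-++⁺ˡ; ∈-++⁺ʳ; ∈-++⁻; ∈-map⁺; ∈-map⁻; ∈-filter⁺; ∈-filter⁻; ∈-allFin; ∈-lookup;
         ∈-tabulate⁺; ∈-deduplicate⁺; ∈-deduplicate⁻)
open import Data.List.Properties
  using (length-++; length-++-sucʳ; length-map; length-tabulate; map-tabulate; map-++; map-∘; map-cong;
         ++-assoc; filter-++; partition-defn)
open import Data.List.Relation.Binary.Permutation.Propositional using (_↭_; ↭⇒↭ₛ; ↭ₛ⇒↭; ↭-sym)
open import Data.List.Relation.Binary.Permutation.Propositional.Properties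
  using (shift; ↭-length; filter-↭; ∈-resp-↭)
import Data.List.Relation.Binary.Permutation.Setoid.Properties as Perm
open import Data.List.Relation.Unary.All as All using (All; []; _∷_)
import Data.List.Relation.Unary.All.Properties as All
open import Data.List.Relation.Unary.AllPairs using ([]; _∷_)
open import Data.List.Relation.Unary.Any as Any using (here; there)
open import Data.List.Relation.Unary.Any.Properties using (lookup-index)
open import Data.List.Relation.Unary.Linked using (Linked; []; [-]; _∷_)
import Data.List.Relation.Unary.Linked.Properties as Linked
open import Data.List.Relation.Unary.Unique.DecPropositional using (unique?)
import Data.List.Relation.Unary.Unique.DecPropositional.Properties as DecUnique
open import Data.List.Relation.Unary.Unique.Propositional using (Unique)
import Data.List.Relation.Unary.Unique.Propositional.Properties as Unique
open import Data.Nat using (ℕ; zero; suc; _+_; _*_; _≤_; _<_; z≤n; s≤s; _≤?_; _≟_)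
open import Data.Nat.DivMod using (_/_; /-monoˡ-≤; m*n/n≡m; m<n*o⇒m/o<n; _divMod_; DivMod; result)
open import Data.Nat.ListAction using (sum)
open import Data.Nat.Properties hiding (_≤?_; _≟_)
open import Data.Nat.Tactic.RingSolver using (solve-∀)
open import Data.Product using (_×_; _,_; proj₁; proj₂; Σ-syntax; ∃-syntax)
open import Data.Sum using (_⊎_; inj₁; inj₂)
import Data.Vec as Vec
open import Data.Vec using ([]; _∷_)
open import Data.Vec.Properties using (lookup∘tabulate; lookup⇒[]=; []=⇒lookup; ++-injectiveʳ)
open import Function using (_∘_)
open import Relation.Binary.Construct.Closure.ReflexiveTransitive
  using (Star; ε; _◅_; _◅◅_; gmap; reverse)
open import Relation.Binary.Definitions using (tri<; tri≈; tri>)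
open import Relation.Binary.PropositionalEquality
  using (_≡_; _≢_; refl; sym; trans; cong; cong₂; subst; setoid)
open import Relation.Nullary using (¬_; Dec; yes; no; does; contradiction; ¬?)
open import Relation.Nullary.Decidable using (dec-true; _×-dec_; from-yes)

private
  variable
    n : ℕ
    A : Set

-- Counting with repetition-free lists and subsets

Unique-resp-↭ : {xs ys : List A} → xs ↭ ys → Unique xs → Unique ys
Unique-resp-↭ = Perm.Unique-resp-↭ (setoid _) ∘ ↭⇒↭ₛ

-- Deleting one occurrence of the head from `ys` keeps every entry of the tail, since these differ
-- from the head. Most cardinality bounds below rest on this.
⊆⇒length≤ : ∀ {xs ys : List A} → Unique xs → (∀ {x} → x ∈ xs → x ∈ ys) → length xs ≤ length ys
⊆⇒length≤ {xs = []} _ _ = z≤n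
⊆⇒length≤ {xs = x ∷ xs} (x∉xs ∷ u) xs⊆ys with ∈-∃++ (xs⊆ys (here refl))
... | as , bs , refl = begin
  suc (length xs)         ≤⟨ s≤s (⊆⇒length≤ u xs⊆as++bs) ⟩
  suc (length (as ++ bs)) ≡⟨ length-++-sucʳ as x bs ⟨
  length (as ++ x ∷ bs)   ∎
  where
  open ≤-Reasoning
  xs⊆as++bs : ∀ {y} → y ∈ xs → y ∈ as ++ bs
  xs⊆as++bs y∈xs with ∈-++⁻ as (xs⊆ys (there y∈xs))
  ... | inj₁ y∈as         = ∈-++⁺ˡ y∈as
  ... | inj₂ (here refl)  = contradiction refl (All.lookup x∉xs y∈xs)
  ... | inj₂ (there y∈bs) = ∈-++⁺ʳ as y∈bs

length-filter-≤ : ∀ {P : A → Set} {P? : ∀ x → Dec (P x)} {xs ys : List A} → Unique xs →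
                  (∀ {x} → x ∈ xs → x ∈ ys) → length (filter P? xs) ≤ length (filter P? ys)
length-filter-≤ {P? = P?} {xs} u xs⊆ys = ⊆⇒length≤ (Unique.filter⁺ P? u) λ x∈ →
  let x∈xs , px = ∈-filter⁻ P? {xs = xs} x∈ in ∈-filter⁺ P? (xs⊆ys x∈xs) px

Unique⇒length≤n : {xs : List (Fin n)} → Unique xs → length xs ≤ n
Unique⇒length≤n {n} {xs} u = begin
  length xs         ≤⟨ ⊆⇒length≤ u (λ {x} _ → ∈-allFin x) ⟩
  length (allFin n) ≡⟨ length-tabulate _ ⟩
  n                 ∎
  where open ≤-Reasoning

elements : Subset n → List (Fin n)
elements {n} S = filter (_∈? S) (allFin n)

∈-elements⁺ : ∀ {S : Subset n} {v} → v ∈ˢ S → v ∈ elements S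
∈-elements⁺ {S = S} {v} = ∈-filter⁺ (_∈? S) (∈-allFin v)

∈-elements⁻ : ∀ {S : Subset n} {v} → v ∈ elements S → v ∈ˢ S
∈-elements⁻ {n} {S} v∈ = proj₂ (∈-filter⁻ (_∈? S) {xs = allFin n} v∈)

elements-unique : (S : Subset n) → Unique (elements S)
elements-unique {n} S = Unique.filter⁺ (_∈? S) (Unique.allFin⁺ n)

length-elements : (S : Subset n) → length (elements S) ≡ ∣ S ∣
length-elements [] = refl
length-elements {suc n} (s ∷ S) =
  -- The tail of `allFin (suc n)` is a `tabulate`; as `map suc (allFin n)` it is open to induction.
  trans (cong (λ xs → length (filter (_∈? (s ∷ S)) (zero ∷ xs))) (sym (map-tabulate (λ i → i) suc))) (go s)
  where
  shifted : ∀ s xs → length (filter (_∈? (s ∷ S)) (map suc xs)) ≡ length (filter (_∈? S) xs)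
  shifted s []       = refl
  shifted s (x ∷ xs) with does (x ∈? S)
  ... | true  = cong suc (shifted s xs)
  ... | false = shifted s xs

  go : ∀ s → length (filter (_∈? (s ∷ S)) (zero ∷ map suc (allFin n))) ≡ ∣ s ∷ S ∣
  go true  = cong suc (trans (shifted true (allFin n)) (length-elements S))
  go false = trans (shifted false (allFin n)) (length-elements S)

∈-tabulateˢ⁺ : ∀ {P : Fin n → Set} (P? : ∀ v → Dec (P v)) {v} → P v → v ∈ˢ Vec.tabulate (does ∘ P?)
∈-tabulateˢ⁺ P? {v} pv = lookup⇒[]= v _ (trans (lookup∘tabulate (does ∘ P?) v) (dec-true (P? v) pv))

∈-tabulateˢ⁻ : ∀ {P : Fin n → Set} (P? : ∀ v → Dec (P v)) {v} → v ∈ˢ Vec.tabulate (does ∘ P?) → P v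
∈-tabulateˢ⁻ P? {v} v∈ with P? v | trans (sym (lookup∘tabulate (does ∘ P?) v)) ([]=⇒lookup v∈)
... | yes pv | _ = pv
... | no _   | ()

Linked-++⁻ˡ : ∀ {R : A → A → Set} xs {ys} → Linked R (xs ++ ys) → Linked R xs
Linked-++⁻ˡ []           _       = []
Linked-++⁻ˡ (x ∷ [])     _       = [-]
Linked-++⁻ˡ (x ∷ y ∷ xs) (r ∷ l) = r ∷ Linked-++⁻ˡ (y ∷ xs) l

Unique-++⁻ˡ : ∀ (xs {ys} : List A) → Unique (xs ++ ys) → Unique xs
Unique-++⁻ˡ []       _       = []
Unique-++⁻ˡ (x ∷ xs) (r ∷ u) = All.++⁻ˡ xs r ∷ Unique-++⁻ˡ xs u

∃-other : ∀ {xs : List (Fin n)} → Unique xs → 2 ≤ length xs → ∀ y → ∃[ z ] (z ∈ xs × z ≢ y)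
∃-other {xs = a ∷ b ∷ _} ((a≢b ∷ _) ∷ _) _ y with a Fin.≟ y
... | no a≢y   = a , here refl , a≢y
... | yes refl = b , there (here refl) , a≢b ∘ sym
∃-other {xs = _ ∷ []} _ (s≤s ()) _

-- Edge counts and the edge bound for forests

module _ (G : Graph n) where
  open Graph G renaming (sym to adj-sym)

  -- The path from `x` to `z` and the edge back form the cycle; `y` lies strictly between them, so
  -- it has at least three vertices.
  chord⇒cycle : ∀ {x y z zs} → IsPath G (x ∷ y ∷ zs) → z ∈ zs → Adj z x → Cycle G
  chord⇒cycle {x} {y} {z} {zs} (l , u) z∈zs zx with ∈-∃++ z∈zs
  ... | as , bs , refl = record
    { u = x ; w = z ; vs = y ∷ as ; vs≢[] = λ ()
    ; isPath = Linked-++⁻ˡ (x ∷ y ∷ as ∷ʳ z) (subst (Linked Adj) eq l)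
             , Unique-++⁻ˡ (x ∷ y ∷ as ∷ʳ z) (subst Unique eq u)
    ; closed = zx }
    where
    eq : x ∷ y ∷ as ++ [ z ] ++ bs ≡ (x ∷ y ∷ as ∷ʳ z) ++ bs
    eq = cong (λ l → x ∷ y ∷ l) (sym (++-assoc as [ z ] bs))

  nbrs : List (Fin n) → Fin n → List (Fin n)
  nbrs xs v = filter (adj? v) xs

  deg : List (Fin n) → Fin n → ℕ
  deg xs v = length (nbrs xs v)

  -- For disjoint lists this is the number of edges between them; an edge inside both lists is
  -- counted from either end.
  cross : List (Fin n) → List (Fin n) → ℕ
  cross xs ys = sum (map (deg ys) xs)

  -- Each edge is counted at the endpoint that comes first in the list, hence once.
  size : List (Fin n) → ℕ
  size []       = 0
  size (x ∷ xs) = deg xs x + size xs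

  deg-++ : ∀ xs ys v → deg (xs ++ ys) v ≡ deg xs v + deg ys v
  deg-++ xs ys v = trans (cong length (filter-++ (adj? v) xs ys)) (length-++ (nbrs xs v))

  cross-++ʳ : ∀ xs ys zs → cross xs (ys ++ zs) ≡ cross xs ys + cross xs zs
  cross-++ʳ []       ys zs = refl
  cross-++ʳ (x ∷ xs) ys zs rewrite deg-++ ys zs x | cross-++ʳ xs ys zs =
    lemma (deg ys x) (deg zs x) (cross xs ys) (cross xs zs)
    where
    lemma : ∀ a b c d → a + b + (c + d) ≡ a + c + (b + d)
    lemma = solve-∀

  +-exchange : ∀ a b c → a + (b + c) ≡ b + (a + c)
  +-exchange = solve-∀

  -- Symmetry of adjacency enters here: the edges at `y` are counted once from `xs` and once from
  -- `y`. Double counting in `cross-comm` follows.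
  cross-∷ʳ : ∀ xs y ys → cross xs (y ∷ ys) ≡ deg xs y + cross xs ys
  cross-∷ʳ []       y ys = refl
  cross-∷ʳ (x ∷ xs) y ys with ih ← cross-∷ʳ xs y ys | adj? x y | adj? y x
  ... | yes _  | yes _  rewrite ih = cong suc (+-exchange (deg ys x) (deg xs y) (cross xs ys))
  ... | no _   | no _   rewrite ih = +-exchange (deg ys x) (deg xs y) (cross xs ys)
  ... | yes xy | no ¬yx = contradiction (adj-sym xy) ¬yx
  ... | no ¬xy | yes yx = contradiction (adj-sym yx) ¬xy

  cross-[]ʳ : ∀ xs → cross xs [] ≡ 0
  cross-[]ʳ []       = refl
  cross-[]ʳ (x ∷ xs) = cross-[]ʳ xs

  cross-comm : ∀ xs ys → cross xs ys ≡ cross ys xs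
  cross-comm []       ys = sym (cross-[]ʳ ys)
  cross-comm (x ∷ xs) ys = trans (cong (deg ys x +_) (cross-comm xs ys)) (sym (cross-∷ʳ ys x xs))

  -- The handshake identity.
  cross-self : ∀ xs → cross xs xs ≡ 2 * size xs
  cross-self []       = refl
  cross-self (x ∷ xs) with adj? x x
  ... | yes xx = contradiction xx (irrefl refl)
  ... | no _   rewrite cross-∷ʳ xs x xs | cross-self xs = lemma (deg xs x) (size xs)
    where
    lemma : ∀ a b → a + (a + 2 * b) ≡ 2 * (a + b)
    lemma = solve-∀

  size-++ : ∀ xs ys → size (xs ++ ys) ≡ size xs + cross xs ys + size ys
  size-++ []       ys = refl
  size-++ (x ∷ xs) ys rewrite deg-++ xs ys x | size-++ xs ys =
    lemma (deg xs x) (deg ys x) (size xs) (cross xs ys) (size ys)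
    where
    lemma : ∀ a b c d e → a + b + (c + d + e) ≡ a + c + (b + d) + e
    lemma = solve-∀

  size-shift : ∀ xs v ys → size (xs ++ v ∷ ys) ≡ deg (xs ++ ys) v + size (xs ++ ys)
  size-shift xs v ys
    rewrite size-++ xs (v ∷ ys) | cross-∷ʳ xs v ys | deg-++ xs ys v | size-++ xs ys =
    lemma (size xs) (deg xs v) (cross xs ys) (deg ys v) (size ys)
    where
    lemma : ∀ a b c d e → a + (b + c) + (d + e) ≡ b + d + (a + c + e)
    lemma = solve-∀

  cross-≥ : ∀ c ys xs → (∀ {x} → x ∈ xs → c ≤ deg ys x) → length xs * c ≤ cross xs ys
  cross-≥ c ys []       _ = z≤n
  cross-≥ c ys (x ∷ xs) h = +-mono-≤ (h (here refl)) (cross-≥ c ys xs (h ∘ there))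

  cross-≤ : ∀ c ys xs → (∀ {x} → x ∈ xs → deg ys x ≤ c) → cross xs ys ≤ length xs * c
  cross-≤ c ys []       _ = z≤n
  cross-≤ c ys (x ∷ xs) h = +-mono-≤ (h (here refl)) (cross-≤ c ys xs (h ∘ there))

  module _ (forest : Forest G) where

    -- Otherwise a path within W could be prolonged for ever.
    leaf : ∀ {W} → Unique W → 1 ≤ length W → ∃[ v ] (v ∈ W × deg W v ≤ 1)
    leaf {W@(w ∷ _)} unique _ with Any.any? (λ v → deg W v ≤? 1) W
    ... | yes any = let v , v∈W , d≤1 = find any in v , v∈W , d≤1
    ... | no none = ⊥-elim (start (next (here refl) w))
      where
      next : ∀ {x} → x ∈ W → ∀ y → ∃[ z ] (z ∈ W × Adj x z × z ≢ y)
      next {x} x∈W y with ∃-other (Unique.filter⁺ (adj? x) unique)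
        (≰⇒> (λ d≤1 → none (Any.map (λ { refl → d≤1 }) x∈W))) y
      ... | z , z∈ , z≢y with ∈-filter⁻ (adj? x) {xs = W} z∈
      ...   | z∈W , xz = z , z∈W , xz , z≢y

      -- `m` counts the prolongations still allowed; once it is 0, the path has more than `n`
      -- distinct vertices.
      prolong : ∀ m {x y zs} → IsPath G (x ∷ y ∷ zs) → x ∈ W → n < m + length (x ∷ y ∷ zs) → ⊥
      prolong zero    (_ , u) _ n<len = <⇒≱ n<len (Unique⇒length≤n u)
      prolong (suc m) {x} {y} {zs} p@(l , u) x∈W n<len with next x∈W y
      ... | z , z∈W , xz , z≢y with DecMembership._∈?_ Fin._≟_ z zs
      ...   | yes z∈zs = forest (chord⇒cycle p z∈zs (adj-sym xz))
      ...   | no z∉zs  = prolong m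
                (adj-sym xz ∷ l , ((λ { refl → irrefl refl xz }) ∷ z≢y ∷ All.¬Any⇒All¬ zs z∉zs) ∷ u) z∈W
                (subst (n <_) (sym (+-suc m _)) n<len)

      start : ∃[ z ] (z ∈ W × Adj w z × z ≢ w) → ⊥
      start (z , z∈W , wz , z≢w) =
        prolong n (adj-sym wz ∷ [-] , (z≢w ∷ []) ∷ [] ∷ []) z∈W (m<m+n n (s≤s z≤n))

    -- Induction by deleting the vertex given by `leaf`, which costs one vertex and at most one
    -- edge.
    forest-size : ∀ {W} → Unique W → 1 ≤ length W → size W < length W
    forest-size {_ ∷ W} = go (length W) refl
      where
      go : ∀ m {W} → suc m ≡ length W → Unique W → 1 ≤ length W → size W < length W
      go zero    {x ∷ []}   _ _ _ = s≤s z≤n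
      go (suc m) {W}     eq u 1≤ with leaf u 1≤
      ... | v , v∈W , deg≤1 with ∈-∃++ v∈W
      ...   | as , bs , refl = begin-strict
        size (as ++ v ∷ bs)                    ≡⟨ size-shift as v bs ⟩
        deg (as ++ bs) v + size (as ++ bs)     <⟨ +-mono-≤-< deg≤1′ (go m len u′ (subst (1 ≤_) len (s≤s z≤n))) ⟩
        1 + length (as ++ bs)                  ≡⟨ length-++-sucʳ as v bs ⟨
        length (as ++ v ∷ bs)                  ∎
        where
        open ≤-Reasoning
        len : suc m ≡ length (as ++ bs)
        len = suc-injective (trans eq (length-++-sucʳ as v bs))
        u′ : Unique (as ++ bs)
        u′ with _ ∷ u″ ← Unique-resp-↭ (shift v as bs) u = u″
        deg≤1′ : deg (as ++ bs) v ≤ 1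
        deg≤1′ = ≤-trans (length-filter-≤ {P? = adj? v} u′ grow) deg≤1
          where
          grow : ∀ {x} → x ∈ as ++ bs → x ∈ as ++ v ∷ bs
          grow x∈ with ∈-++⁻ as x∈
          ... | inj₁ x∈as = ∈-++⁺ˡ x∈as
          ... | inj₂ x∈bs = ∈-++⁺ʳ as (there x∈bs)

  -- Upper bound: the classes of a fixed set

  module _ (S : Subset n) where

    private
      ss : List (Fin n)
      ss = elements S

    class : Fin n → Subset n
    class u = N[_] G u ∩ S

    ∈-class⁺ : ∀ {u v} → v ∈ˢ S → v ≡ u ⊎ Adj u v → v ∈ˢ class u
    ∈-class⁺ {u} v∈S (inj₁ refl) = x∈p∩q⁺ (x∈p∪q⁺ (inj₁ (x∈⁅x⁆ u)) , v∈S)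
    ∈-class⁺ {u} v∈S (inj₂ uv)   = x∈p∩q⁺ (x∈p∪q⁺ (inj₂ (∈-tabulateˢ⁺ (adj? u) uv)) , v∈S)

    ∈-class⁻ : ∀ {u v} → v ∈ˢ class u → v ∈ˢ S × (v ≡ u ⊎ v ∈ nbrs ss u)
    ∈-class⁻ {u} {v} v∈ with x∈p∩q⁻ (N[_] G u) S v∈
    ... | v∈N , v∈S with x∈p∪q⁻ ⁅ u ⁆ (N⟨_⟩ G u) v∈N
    ...   | inj₁ v∈u  = v∈S , inj₁ (x∈⁅y⁆⇒x≡y u v∈u)
    ...   | inj₂ v∈N′ = v∈S , inj₂ (∈-filter⁺ (adj? u) (∈-elements⁺ v∈S) (∈-tabulateˢ⁻ (adj? u) v∈N′))

    ∈-nbrs⁻ : ∀ {u v} → v ∈ nbrs ss u → v ∈ˢ S × Adj u v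
    ∈-nbrs⁻ {u} v∈ with ∈-filter⁻ (adj? u) {xs = ss} v∈
    ... | v∈ss , uv = ∈-elements⁻ v∈ss , uv

    leaf? : ∀ v → Dec (deg ss v ≤ 1)
    leaf? v = deg ss v ≤? 1

    outer? : ∀ v → Dec (¬ v ∈ˢ S × 2 ≤ deg ss v)
    outer? v = ¬? (v ∈? S) ×-dec (2 ≤? deg ss v)

    -- These are A, B and M of the overview. Only neighbours in `S` are counted, so a vertex of
    -- `leaves` may have any degree in `G`.
    leaves branches outers : List (Fin n)
    leaves   = filter leaf? ss
    branches = filter (¬? ∘ leaf?) ss
    outers   = filter outer? (allFin n)

    ss↭ : ss ↭ leaves ++ branches
    ss↭ = subst (λ (as , bs) → ss ↭ as ++ bs) (partition-defn leaf? ss)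
                (↭ₛ⇒↭ (Perm.partition-↭ (setoid _) leaf? ss))

    -- The edges inside `xs` or from `xs` to `ys`, as two-element sets. The recursion follows that
    -- of `size`, so that the length can be computed.
    pairs : List (Fin n) → List (Fin n) → List (Subset n)
    pairs []       ys = []
    pairs (x ∷ xs) ys = map (λ y → ⁅ x ⁆ ∪ ⁅ y ⁆) (nbrs (xs ++ ys) x) ++ pairs xs ys

    length-pairs : ∀ xs ys → length (pairs xs ys) ≡ size xs + cross xs ys
    length-pairs []       ys = refl
    length-pairs (x ∷ xs) ys
      rewrite length-++ (map (λ y → ⁅ x ⁆ ∪ ⁅ y ⁆) (nbrs (xs ++ ys) x)) {pairs xs ys}
            | length-map (λ y → ⁅ x ⁆ ∪ ⁅ y ⁆) (nbrs (xs ++ ys) x)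
            | deg-++ xs ys x | length-pairs xs ys =
      lemma (deg xs x) (deg ys x) (size xs) (cross xs ys)
      where
      lemma : ∀ a b c d → a + b + (c + d) ≡ a + c + (b + d)
      lemma = solve-∀

    ∈-pairs : ∀ {x y xs ys} → Adj x y → x ∈ xs → y ∈ xs ++ ys → ⁅ x ⁆ ∪ ⁅ y ⁆ ∈ pairs xs ys
    ∈-pairs xy (here refl) (here refl) = contradiction xy (irrefl refl)
    ∈-pairs xy (here refl) (there y∈)  = ∈-++⁺ˡ (∈-map⁺ _ (∈-filter⁺ (adj? _) y∈ xy))
    -- Here `y` precedes `x`, so the edge is listed at `y` with its ends in the other order.
    ∈-pairs {x} {y} xy (there x∈) (here refl) = subst (_∈ _) (∪-comm ⁅ y ⁆ ⁅ x ⁆)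
      (∈-++⁺ˡ (∈-map⁺ _ (∈-filter⁺ (adj? _) (∈-++⁺ˡ x∈) (adj-sym xy))))
    ∈-pairs xy (there x∈) (there y∈)   = ∈-++⁺ʳ _ (∈-pairs xy x∈ y∈)

    -- Repetitions are harmless, as only an upper bound is wanted. Vertices of `leaves` need no
    -- entries of their own: their classes are singletons or edges.
    cover : List (Subset n)
    cover = Sub.⊥ ∷ map ⁅_⁆ ss ++ map class outers ++ map class branches ++ pairs leaves branches

    -- The cases are membership of `u` in `S` and whether `u` has no, one or several neighbours in
    -- `S`.
    class∈cover : ∀ u → class u ∈ cover
    class∈cover u with u ∈? S | nbrs ss u in eq
    ... | yes u∈S | [] = there (∈-++⁺ˡ (subst (_∈ map ⁅_⁆ ss) (sym class≡) (∈-map⁺ ⁅_⁆ (∈-elements⁺ u∈S))))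
      where
      class≡ : class u ≡ ⁅ u ⁆
      class≡ = ⊆-antisym to from
        where
        to : class u Sub.⊆ ⁅ u ⁆
        to v∈ with ∈-class⁻ v∈
        ... | _ , inj₁ refl = x∈⁅x⁆ u
        ... | _ , inj₂ v∈′ with () ← subst (_ ∈_) eq v∈′
        from : ⁅ u ⁆ Sub.⊆ class u
        from v∈ = ∈-class⁺ (subst (_∈ˢ S) (sym (x∈⁅y⁆⇒x≡y u v∈)) u∈S) (inj₁ (x∈⁅y⁆⇒x≡y u v∈))
    ... | yes u∈S | y ∷ [] = there (∈-++⁺ʳ (map ⁅_⁆ ss) (∈-++⁺ʳ (map class outers) (∈-++⁺ʳ (map class branches)
        (subst (_∈ pairs leaves branches) (sym class≡)
          (∈-pairs (proj₂ y-nbr) u∈leaves (∈-resp-↭ ss↭ (∈-elements⁺ (proj₁ y-nbr))))))))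
      where
      y-nbr : y ∈ˢ S × Adj u y
      y-nbr = ∈-nbrs⁻ (subst (y ∈_) (sym eq) (here refl))
      u∈leaves : u ∈ leaves
      u∈leaves = ∈-filter⁺ leaf? (∈-elements⁺ u∈S) (≤-reflexive (cong length eq))
      class≡ : class u ≡ ⁅ u ⁆ ∪ ⁅ y ⁆
      class≡ = ⊆-antisym to from
        where
        to : class u Sub.⊆ ⁅ u ⁆ ∪ ⁅ y ⁆
        to v∈ with ∈-class⁻ v∈
        ... | _ , inj₁ refl = x∈p∪q⁺ (inj₁ (x∈⁅x⁆ u))
        ... | _ , inj₂ v∈′ with subst (_ ∈_) eq v∈′
        ...   | here refl = x∈p∪q⁺ (inj₂ (x∈⁅x⁆ y))
        from : ⁅ u ⁆ ∪ ⁅ y ⁆ Sub.⊆ class u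
        from v∈ with x∈p∪q⁻ ⁅ u ⁆ ⁅ y ⁆ v∈
        ... | inj₁ v∈u with refl ← x∈⁅y⁆⇒x≡y u v∈u = ∈-class⁺ u∈S (inj₁ refl)
        ... | inj₂ v∈y with refl ← x∈⁅y⁆⇒x≡y y v∈y = ∈-class⁺ (proj₁ y-nbr) (inj₂ (proj₂ y-nbr))
    ... | yes u∈S | _ ∷ _ ∷ _ = there (∈-++⁺ʳ (map ⁅_⁆ ss) (∈-++⁺ʳ (map class outers) (∈-++⁺ˡ
        (∈-map⁺ class (∈-filter⁺ (¬? ∘ leaf?) (∈-elements⁺ u∈S)
          (<⇒≱ (subst (λ l → 2 ≤ length l) (sym eq) (s≤s (s≤s z≤n)))))))))
    ... | no u∉S | [] = here (⊆-antisym to λ v∈ → ⊥-elim (∉⊥ v∈))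
      where
      to : class u Sub.⊆ Sub.⊥
      to v∈ with ∈-class⁻ v∈
      ... | v∈S , inj₁ refl = contradiction v∈S u∉S
      ... | _ , inj₂ v∈′ with () ← subst (_ ∈_) eq v∈′
    ... | no u∉S | y ∷ [] = there (∈-++⁺ˡ (subst (_∈ map ⁅_⁆ ss) (sym class≡)
                                    (∈-map⁺ ⁅_⁆ (∈-elements⁺ (proj₁ y-nbr)))))
      where
      y-nbr : y ∈ˢ S × Adj u y
      y-nbr = ∈-nbrs⁻ (subst (y ∈_) (sym eq) (here refl))
      class≡ : class u ≡ ⁅ y ⁆
      class≡ = ⊆-antisym to from
        where
        to : class u Sub.⊆ ⁅ y ⁆
        to v∈ with ∈-class⁻ v∈
        ... | v∈S , inj₁ refl = contradiction v∈S u∉S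
        ... | _ , inj₂ v∈′ with subst (_ ∈_) eq v∈′
        ...   | here refl = x∈⁅x⁆ y
        from : ⁅ y ⁆ Sub.⊆ class u
        from v∈ with refl ← x∈⁅y⁆⇒x≡y y v∈ = ∈-class⁺ (proj₁ y-nbr) (inj₂ (proj₂ y-nbr))
    ... | no u∉S | _ ∷ _ ∷ _ = there (∈-++⁺ʳ (map ⁅_⁆ ss) (∈-++⁺ˡ
        (∈-map⁺ class (∈-filter⁺ outer? (∈-allFin u)
          (u∉S , subst (λ l → 2 ≤ length l) (sym eq) (s≤s (s≤s z≤n)))))))

    ncSet≤cover : ncSet G S ≤ length cover
    ncSet≤cover = ⊆⇒length≤ (DecUnique.deduplicate-! _≟ˢ_ (map class (allFin n))) λ T∈ →
      let u , _ , T≡ = ∈-map⁻ class (∈-deduplicate⁻ _≟ˢ_ (map class (allFin n)) T∈)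
      in subst (_∈ cover) (sym T≡) (class∈cover u)

    module _ (forest : Forest G) (1≤k : 1 ≤ ∣ S ∣) where

      private
        a b k o eₐ e_b x : ℕ
        a = length leaves
        b = length branches
        k = ∣ S ∣
        o = length outers
        eₐ = size leaves
        e_b = size branches
        x = cross leaves branches

      length-cover : length cover ≡ 1 + (k + (o + (b + (eₐ + x))))
      length-cover
        rewrite length-++ (map ⁅_⁆ ss) {map class outers ++ map class branches ++ pairs leaves branches}
              | length-++ (map class outers) {map class branches ++ pairs leaves branches}
              | length-++ (map class branches) {pairs leaves branches}
              | length-map ⁅_⁆ ss | length-map class outers | length-map class branches
              | length-elements S | length-pairs leaves branches = refl

      k≡a+b : k ≡ a + b
      k≡a+b = trans (sym (length-elements S)) (trans (↭-length ss↭) (length-++ leaves))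

      deg-ss : ∀ v → deg ss v ≡ deg leaves v + deg branches v
      deg-ss v = trans (↭-length (filter-↭ (adj? v) ss↭)) (deg-++ leaves branches v)

      -- A vertex of A has at most one neighbour in `S`, hence at most one in B.
      x≤a : x ≤ a
      x≤a = subst (x ≤_) (*-identityʳ a) (cross-≤ 1 branches leaves λ {v} v∈ → begin
        deg branches v                ≤⟨ m≤n+m _ _ ⟩
        deg leaves v + deg branches v ≡⟨ deg-ss v ⟨
        deg ss v                      ≤⟨ proj₂ (∈-filter⁻ leaf? {xs = ss} v∈) ⟩
        1                             ∎)
        where open ≤-Reasoning

      -- Sum the degrees within `S` over B: edges inside B count twice, edges to A once.
      2b≤a+2e : b * 2 ≤ a + 2 * e_b
      2b≤a+2e = begin
        b * 2                                           ≤⟨ cross-≥ 2 (leaves ++ branches) branches deg≥2 ⟩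
        cross branches (leaves ++ branches)             ≡⟨ cross-++ʳ branches leaves branches ⟩
        cross branches leaves + cross branches branches ≡⟨ cong₂ _+_ (cross-comm branches leaves) (cross-self branches) ⟩
        x + 2 * e_b                                     ≤⟨ +-monoˡ-≤ (2 * e_b) x≤a ⟩
        a + 2 * e_b                                     ∎
        where
        open ≤-Reasoning
        deg≥2 : ∀ {v} → v ∈ branches → 2 ≤ deg (leaves ++ branches) v
        deg≥2 {v} v∈ = subst (2 ≤_) (↭-length (filter-↭ (adj? v) ss↭))
                         (≰⇒> (proj₂ (∈-filter⁻ (¬? ∘ leaf?) {xs = ss} v∈)))

      W : List (Fin n)
      W = outers ++ leaves ++ branches

      W-unique : Unique W
      W-unique = Unique.++⁺ (Unique.filter⁺ outer? (Unique.allFin⁺ n)) (Unique-resp-↭ ss↭ (elements-unique S))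
        λ (v∈o , v∈s) → proj₁ (proj₂ (∈-filter⁻ outer? {xs = allFin n} v∈o))
                              (∈-elements⁻ (∈-resp-↭ (↭-sym ss↭) v∈s))

      -- Apply `forest-size` to `W`, which is nonempty because `S` is. Drop the edges inside M,
      -- count two edges into `S` for each vertex of M, and cancel one `o`.
      o-bound : 1 + (eₐ + x + e_b) + o ≤ a + b
      o-bound = +-cancelˡ-≤ o _ _ (begin
        o + (1 + (eₐ + x + e_b) + o)   ≡⟨ lemma o (eₐ + x + e_b) ⟩
        suc (o * 2 + (eₐ + x + e_b))   ≤⟨ s≤s (+-mono-≤ 2o≤cross (≤-reflexive (sym (size-++ leaves branches)))) ⟩
        suc (cross outers (leaves ++ branches) + size (leaves ++ branches))
          ≤⟨ s≤s (+-monoˡ-≤ (size (leaves ++ branches)) (m≤n+m (cross outers (leaves ++ branches)) (size outers))) ⟩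
        suc (size outers + cross outers (leaves ++ branches) + size (leaves ++ branches))
          ≡⟨ cong suc (size-++ outers (leaves ++ branches)) ⟨
        suc (size W)                   ≤⟨ forest-size forest W-unique (subst (1 ≤_) (sym length-W) 1≤o+a+b) ⟩
        length W                       ≡⟨ length-W ⟩
        o + (a + b)                    ∎)
        where
        open ≤-Reasoning
        length-W : length W ≡ o + (a + b)
        length-W = trans (length-++ outers) (cong (o +_) (length-++ leaves))
        1≤o+a+b : 1 ≤ o + (a + b)
        1≤o+a+b = ≤-trans (subst (1 ≤_) k≡a+b 1≤k) (m≤n+m (a + b) o)
        lemma : ∀ o e → o + (1 + e + o) ≡ suc (o * 2 + e)
        lemma = solve-∀
        2o≤cross : o * 2 ≤ cross outers (leaves ++ branches)
        2o≤cross = cross-≥ 2 (leaves ++ branches) outers λ {v} v∈ →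
          subst (2 ≤_) (↭-length (filter-↭ (adj? v) ss↭)) (proj₂ (proj₂ (∈-filter⁻ outer? {xs = allFin n} v∈)))

      ncSet-bound : ncSet G S ≤ (7 * k) / 3
      ncSet-bound = begin
        ncSet G S         ≡⟨ m*n/n≡m (ncSet G S) 3 ⟨
        ncSet G S * 3 / 3 ≤⟨ /-monoˡ-≤ 3 3nc≤7k ⟩
        7 * k / 3         ∎
        where
        open ≤-Reasoning
        regroup : ∀ a b o e x f → (1 + (a + b + (o + (b + (e + x))))) * 3 + 3 * f
                                ≡ 3 * (1 + (e + x + f) + o) + b * 2 + (3 * a + 4 * b)
        regroup = solve-∀
        collect : ∀ a b f → 3 * (a + b) + (a + 2 * f) + (3 * a + 4 * b) ≡ 7 * (a + b) + 2 * f
        collect = solve-∀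
        -- Three times `o-bound` plus `2b≤a+2e`. The added `3 * e_b` supplies the edges inside B
        -- that `o-bound` needs; `2 * e_b` of it comes back on the right, so it can be cancelled.
        3nc≤7k : ncSet G S * 3 ≤ 7 * k
        3nc≤7k = +-cancelʳ-≤ (3 * e_b) _ _ (begin
          ncSet G S * 3 + 3 * e_b    ≤⟨ +-monoˡ-≤ (3 * e_b) (*-monoˡ-≤ 3 (≤-trans ncSet≤cover (≤-reflexive length-cover))) ⟩
          (1 + (k + (o + (b + (eₐ + x))))) * 3 + 3 * e_b
            ≡⟨ cong (λ k → (1 + (k + (o + (b + (eₐ + x))))) * 3 + 3 * e_b) k≡a+b ⟩
          (1 + (a + b + (o + (b + (eₐ + x))))) * 3 + 3 * e_b ≡⟨ regroup a b o eₐ x e_b ⟩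
          3 * (1 + (eₐ + x + e_b) + o) + b * 2 + (3 * a + 4 * b)
            ≤⟨ +-monoˡ-≤ (3 * a + 4 * b) (+-mono-≤ (*-monoʳ-≤ 3 o-bound) 2b≤a+2e) ⟩
          3 * (a + b) + (a + 2 * e_b) + (3 * a + 4 * b) ≡⟨ collect a b e_b ⟩
          7 * (a + b) + 2 * e_b      ≤⟨ +-monoʳ-≤ (7 * (a + b)) (*-monoˡ-≤ e_b (n≤1+n 2)) ⟩
          7 * (a + b) + 3 * e_b      ≡⟨ cong (λ k → 7 * k + 3 * e_b) k≡a+b ⟨
          7 * k + 3 * e_b            ∎)

-- The case k = 0 is excluded: in a nonempty graph the empty set has one class, the empty one.
nc-bound : ∀ n (F : Graph n) k → Forest F → 1 ≤ k → nc F k ≤ (7 * k) / 3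
nc-bound n F k forest 1≤k = max≤v⁺ z≤n (All.map⁺ (All.tabulate λ {S} S∈ →
  let ∣S∣≡k = proj₂ (∈-filter⁻ (λ S → ∣ S ∣ ≟ k) {xs = subsets n} S∈)
  in subst (λ k → ncSet F S ≤ 7 * k / 3) ∣S∣≡k (ncSet-bound F S forest (subst (1 ≤_) (sym ∣S∣≡k) 1≤k))))

-- Pathwidth of caterpillars

distinct⇒2≤ : ∀ {S : Subset n} {x y} → x ∈ˢ S → y ∈ˢ S → x ≢ y → 2 ≤ ∣ S ∣
distinct⇒2≤ {S = S} x∈S y∈S x≢y = subst (2 ≤_) (length-elements S)
  (⊆⇒length≤ ((x≢y ∷ []) ∷ [] ∷ []) λ { (here refl) → ∈-elements⁺ x∈S ; (there (here refl)) → ∈-elements⁺ y∈S })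

-- Of three distinct elements, two would share a cell.
two-cells⇒≤2 : ∀ (S : Subset n) {P Q : Fin n → Set} → (∀ {x} → x ∈ˢ S → P x ⊎ Q x) →
               (∀ {x y} → P x → P y → x ≡ y) → (∀ {x y} → Q x → Q y → x ≡ y) → ∣ S ∣ ≤ 2
two-cells⇒≤2 S {P} {Q} cell P! Q! =
  subst (_≤ 2) (length-elements S) (go (elements S) (elements-unique S) (cell ∘ ∈-elements⁻))
  where
  go : ∀ xs → Unique xs → (∀ {x} → x ∈ xs → P x ⊎ Q x) → length xs ≤ 2
  go []           _ _ = z≤n
  go (_ ∷ [])     _ _ = s≤s z≤n
  go (_ ∷ _ ∷ []) _ _ = s≤s (s≤s z≤n)
  go (x ∷ y ∷ z ∷ xs) ((x≢y ∷ x≢z ∷ _) ∷ (y≢z ∷ _) ∷ _) c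
    with c {x} (here refl) | c {y} (there (here refl)) | c {z} (there (there (here refl)))
  ... | inj₁ p | inj₁ q | _      = contradiction (P! p q) x≢y
  ... | inj₁ p | inj₂ _ | inj₁ r = contradiction (P! p r) x≢z
  ... | inj₁ _ | inj₂ q | inj₂ r = contradiction (Q! q r) y≢z
  ... | inj₂ p | inj₂ q | _      = contradiction (Q! p q) x≢y
  ... | inj₂ p | inj₁ _ | inj₂ r = contradiction (Q! p r) x≢z
  ... | inj₂ _ | inj₁ q | inj₁ r = contradiction (P! q r) y≢z

lookup-injective : ∀ {xs : List A} → Unique xs → ∀ i j → lookup xs i ≡ lookup xs j → i ≡ j
lookup-injective {xs = _ ∷ _} _ zero zero _ = refl
lookup-injective {xs = _ ∷ _} (x∉ ∷ _) zero (suc j) eq = contradiction eq (All.lookup x∉ (∈-lookup j))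
lookup-injective {xs = _ ∷ _} (x∉ ∷ _) (suc i) zero eq = contradiction (sym eq) (All.lookup x∉ (∈-lookup i))
lookup-injective {xs = _ ∷ _} (_ ∷ u) (suc i) (suc j) eq = cong suc (lookup-injective u i j eq)

module _ (G : Graph n) where
  open Graph G renaming (sym to adj-sym)
  1≤width : ∀ {u v} → Adj u v → (D : PathDecomposition G) → 1 ≤ PathDecomposition.width D
  1≤width {u} {v} uv D with PathDecomposition.edgeCover D uv
  ... | i , u∈ , v∈ = ∸-monoˡ-≤ 1 (≤-trans (distinct⇒2≤ u∈ v∈ λ { refl → irrefl refl uv })
                        (All.lookup (xs≤max 0 (tabulate (λ i → ∣ bag i ∣))) (∈-tabulate⁺ i)))
    where open PathDecomposition D

  -- An edge from the first vertex to one beyond the second closes a cycle; dropping first vertices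
  -- reduces every other pair to this case.
  chordless : Forest G → ∀ {p} → IsPath G p → ∀ i j → toℕ i < toℕ j →
              Adj (lookup p j) (lookup p i) → toℕ j ≡ suc (toℕ i)
  chordless forest {_ ∷ _ ∷ _} path zero (suc zero) _ _ = refl
  chordless forest {_ ∷ _ ∷ _} path zero (suc (suc j)) _ ji =
    ⊥-elim (forest (chord⇒cycle G path (∈-lookup j) ji))
  chordless forest {_ ∷ _ ∷ _} (_ ∷ l , _ ∷ u) (suc i) (suc j) (s≤s i<j) ji =
    cong suc (chordless forest (l , u) i j i<j ji)
  chordless forest {_ ∷ []} _ _ zero ()

  module _ (conn : ∀ u v → Star Adj u v) (forest : Forest G) {p : List (Fin n)} (path : IsPath G p)
           (branch∈p : ∀ v → 2 ≤ degree G v → v ∈ p) {z : Fin n} (z∈p : z ∈ p) where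

    -- Two different neighbours would give `v` degree at least 2 and so put it on `p`.
    only-nbr : ∀ {u v w} → v ∉ p → Adj v u → Adj v w → u ≡ w
    only-nbr {u} {v} {w} v∉p vu vw with u Fin.≟ w
    ... | yes u≡w = u≡w
    ... | no u≢w  = contradiction
      (branch∈p v (distinct⇒2≤ (∈-tabulateˢ⁺ (adj? v) vu) (∈-tabulateˢ⁺ (adj? v) vw) u≢w)) v∉p

    -- A vertex off the path without a neighbour on it would form, together with its only
    -- neighbour, a component missing z.
    not-isolated : ∀ {v} → v ∉ p → ¬ (All (λ u → ¬ Adj v u) p)
    not-isolated {v} v∉p none = outside-p (stays (conn v z) (inj₁ refl)) z∈p
      where
      outside-p : ∀ {x} → x ≡ v ⊎ Adj v x → x ∉ p
      outside-p (inj₁ refl) = v∉p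
      outside-p (inj₂ vx) x∈p = All.lookup none x∈p vx
      stays : ∀ {x y} → Star Adj x y → x ≡ v ⊎ Adj v x → y ≡ v ⊎ Adj v y
      stays ε q = q
      stays (xy ◅ r) (inj₁ refl) = stays r (inj₂ xy)
      stays (xy ◅ r) (inj₂ vx)   = stays r (inj₁ (only-nbr (outside-p (inj₂ vx)) xy (adj-sym vx)))

    data Place (v : Fin n) : Set where
      on-path : ∀ i → lookup p i ≡ v → Place v
      off-path   : v ∉ p → ∀ i → Adj v (lookup p i) → Place v

    place : ∀ v → Place v
    place v with DecMembership._∈?_ Fin._≟_ v p
    ... | yes v∈p = on-path (Any.index v∈p) (sym (lookup-index v∈p))
    ... | no v∉p with Any.any? (adj? v) p
    ...   | yes a = off-path v∉p (Any.index a) (lookup-index a)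
    ...   | no ¬a = contradiction (All.¬Any⇒All¬ p ¬a) (not-isolated v∉p)

    -- The i-th path vertex occupies the interval [i N , (i + 1) N], where N = n + 1, and its
    -- neighbour v off the path the single point i N + v + 1.
    start′ stop′ : ∀ {v} → Place v → ℕ
    start′ (on-path i _)     = toℕ (combine i (zero {n}))
    start′ {v} (off-path _ i _) = toℕ (combine i (suc v))
    stop′ (on-path i _)       = suc n * suc (toℕ i)
    stop′ l@(off-path _ _ _)     = start′ l

    start stop : Fin n → ℕ
    start v = start′ (place v)
    stop v  = stop′ (place v)

    start-on-path : ∀ (i : Fin (length p)) → toℕ (combine i (zero {n})) ≡ suc n * toℕ i
    start-on-path i = trans (toℕ-combine i (zero {n})) (+-identityʳ _)

    start≤stop : ∀ v → start v ≤ stop v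
    start≤stop v with place v
    ... | on-path i _ = ≤-trans (≤-reflexive (start-on-path i)) (*-monoʳ-≤ (suc n) (n≤1+n (toℕ i)))
    ... | off-path _ _ _ = ≤-refl

    -- `combine` is injective, so a start determines both the path index and the offset; the offset
    -- is 0 on the path and names the vertex off it.
    start-injective : ∀ {v w} → start v ≡ start w → v ≡ w
    start-injective {v} {w} eq with place v | place w
    ... | on-path i refl | on-path j refl =
      cong (lookup p) (proj₁ (combine-injective i zero j zero (toℕ-injective eq)))
    ... | on-path i _ | off-path _ j _
      with () ← proj₂ (combine-injective i zero j (suc w) (toℕ-injective eq))
    ... | off-path _ i _ | on-path j _
      with () ← proj₂ (combine-injective i (suc v) j zero (toℕ-injective eq))
    ... | off-path _ i _ | off-path _ j _
      with refl ← proj₂ (combine-injective i (suc v) j (suc w) (toℕ-injective eq)) = refl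

    -- Without their starting points, the intervals of off-path vertices are empty and those of path
    -- vertices are disjoint.
    interior-injective : ∀ {t v w} → start v < t × t ≤ stop v → start w < t × t ≤ stop w → v ≡ w
    interior-injective {t} {v} {w} (v<t , t≤v) (w<t , t≤w) with place v | place w
    ... | off-path _ _ _    | _            = contradiction v<t (≤⇒≯ t≤v)
    ... | on-path _ _    | off-path _ _ _    = contradiction w<t (≤⇒≯ t≤w)
    ... | on-path i refl | on-path j refl =
      cong (lookup p) (toℕ-injective (≤-antisym (below i j v<t t≤w) (below j i w<t t≤v)))
      where
      below : ∀ (i j : Fin (length p)) → toℕ (combine i (zero {n})) < t → t ≤ suc n * suc (toℕ j) → toℕ i ≤ toℕ j
      below i j i<t t≤j = ≤-pred (*-cancelˡ-< (suc n) (toℕ i) (suc (toℕ j))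
        (subst (_< _) (start-on-path i) (<-≤-trans i<t t≤j)))

    start< : ∀ v → start v < suc (length p * suc n)
    start< v with place v
    ... | on-path i _ = m<n⇒m<1+n (toℕ<n (combine i (zero {n})))
    ... | off-path _ i _ = m<n⇒m<1+n (toℕ<n (combine i (suc v)))

    meets? : ∀ t v → Dec (start v ≤ t × t ≤ stop v)
    meets? t v = start v ≤? t ×-dec t ≤? stop v

    bags : Fin (suc (length p * suc n)) → Subset n
    bags t = Vec.tabulate (does ∘ meets? (toℕ t))

    -- The common bag is the one at `start v`.
    meet : ∀ u v → start u ≤ start v → start v ≤ stop u → ∃[ t ] (u ∈ˢ bags t × v ∈ˢ bags t)
    meet u v u≤v v≤u = fromℕ< (start< v) , in-bag u≤v v≤u , in-bag ≤-refl (start≤stop v)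
      where
      in-bag : ∀ {w} → start w ≤ start v → start v ≤ stop w → w ∈ˢ bags (fromℕ< (start< v))
      in-bag {w} w≤v v≤w = ∈-tabulateˢ⁺ (meets? _)
        (subst (λ t → start w ≤ t × t ≤ stop w) (sym (toℕ-fromℕ< (start< v))) (w≤v , v≤w))

    successive : ∀ (i j : Fin (length p)) → toℕ j ≡ suc (toℕ i) →
                 toℕ (combine i (zero {n})) ≤ toℕ (combine j (zero {n}))
                 × toℕ (combine j (zero {n})) ≤ suc n * suc (toℕ i)
    successive i j j≡1+i rewrite start-on-path i | start-on-path j | j≡1+i =
      *-monoʳ-≤ (suc n) (n≤1+n (toℕ i)) , ≤-refl

    attached : ∀ (i : Fin (length p)) (v : Fin n) → toℕ (combine i (zero {n})) ≤ toℕ (combine i (suc v))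
               × toℕ (combine i (suc v)) ≤ suc n * suc (toℕ i)
    attached i v rewrite toℕ-combine i (zero {n}) | toℕ-combine i (suc v) =
      +-monoʳ-≤ (suc n * toℕ i) z≤n , (begin
        suc n * toℕ i + suc (toℕ v) ≤⟨ +-monoʳ-≤ (suc n * toℕ i) (s≤s (<⇒≤ (toℕ<n v))) ⟩
        suc n * toℕ i + suc n       ≡⟨ +-comm (suc n * toℕ i) (suc n) ⟩
        suc n + suc n * toℕ i       ≡⟨ *-suc (suc n) (toℕ i) ⟨
        suc n * suc (toℕ i)         ∎)
      where open ≤-Reasoning

    off-path-at : ∀ i j {v} → v ∉ p → Adj v (lookup p i) → Adj v (lookup p j) → i ≡ j
    off-path-at i j v∉p vi vj = lookup-injective (proj₂ path) i j (only-nbr v∉p vi vj)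

    -- Adjacent path vertices are consecutive, an off-path vertex sits inside the interval of its
    -- only neighbour, and two off-path vertices are never adjacent, since that neighbour lies on
    -- `p`.
    touch : ∀ {u v} → Adj u v → (P : Place u) (Q : Place v) →
            (start′ P ≤ start′ Q × start′ Q ≤ stop′ P) ⊎ (start′ Q ≤ start′ P × start′ P ≤ stop′ Q)
    touch uv (on-path i refl) (on-path j refl) with <-cmp (toℕ i) (toℕ j)
    ... | tri< i<j _ _ = inj₁ (successive i j (chordless forest path i j i<j (adj-sym uv)))
    ... | tri> _ _ j<i = inj₂ (successive j i (chordless forest path j i j<i uv))
    ... | tri≈ _ i≡j _ = contradiction uv (irrefl (cong (lookup p) (toℕ-injective i≡j)))
    touch {v = v} uv (on-path i refl) (off-path v∉p j vj)
      with refl ← off-path-at i j v∉p (adj-sym uv) vj = inj₁ (attached i v)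
    touch {u = u} uv (off-path u∉p i ui) (on-path j refl)
      with refl ← off-path-at j i u∉p uv ui = inj₂ (attached j u)
    touch uv (off-path u∉p i ui) (off-path v∉p j vj) =
      contradiction (subst (_∈ p) (only-nbr u∉p ui uv) (∈-lookup i)) v∉p

    edge-meets : ∀ {u v} → Adj u v → ∃[ t ] (u ∈ˢ bags t × v ∈ˢ bags t)
    edge-meets {u} {v} uv with touch uv (place u) (place v)
    ... | inj₁ (u≤v , v≤u) = meet u v u≤v v≤u
    ... | inj₂ (v≤u , u≤v) with meet v u v≤u u≤v
    ...   | t , v∈ , u∈ = t , u∈ , v∈

    intervals : PathDecomposition G
    intervals = record
      { m           = suc (length p * suc n)
      ; bag         = bags
      ; vertexCover = λ v → let t , v∈ , _ = meet v v ≤-refl (start≤stop v) in t , v∈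
      ; edgeCover   = edge-meets
      ; interval    = λ {v} {i} {j} {k} i≤j j≤k v∈i v∈k → ∈-tabulateˢ⁺ (meets? (toℕ j))
          ( ≤-trans (proj₁ (∈-tabulateˢ⁻ (meets? (toℕ i)) v∈i)) i≤j
          , ≤-trans j≤k (proj₂ (∈-tabulateˢ⁻ (meets? (toℕ k)) v∈k)))
      }

    -- At most one interval starts at `t`, and at most one that started earlier still contains `t`.
    ∣bag∣≤2 : ∀ t → ∣ bags t ∣ ≤ 2
    ∣bag∣≤2 t = two-cells⇒≤2 (bags t)
      {λ v → start v ≡ toℕ t} {λ v → start v < toℕ t × toℕ t ≤ stop v} cell
      (λ v≡t w≡t → start-injective (trans v≡t (sym w≡t))) interior-injective
      where
      cell : ∀ {v} → v ∈ˢ bags t → start v ≡ toℕ t ⊎ (start v < toℕ t × toℕ t ≤ stop v)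
      cell {v} v∈ with ∈-tabulateˢ⁻ (meets? (toℕ t)) v∈
      ... | v≤t , t≤v with m≤n⇒m<n∨m≡n v≤t
      ...   | inj₁ v<t = inj₂ (v<t , t≤v)
      ...   | inj₂ v≡t = inj₁ v≡t

    width≤1 : PathDecomposition.width intervals ≤ 1
    width≤1 = ∸-monoˡ-≤ 1 (max≤v⁺ {⊥ = 0} z≤n (All.tabulate⁺ ∣bag∣≤2))

  degree≥1⇒nbr : ∀ {v} → 1 ≤ degree G v → ∃[ u ] Adj v u
  degree≥1⇒nbr {v} 1≤d with elements (N⟨_⟩ G v) in eq
  ... | []    = contradiction (subst (1 ≤_) (trans (sym (length-elements (N⟨_⟩ G v))) (cong length eq)) 1≤d) λ ()
  ... | u ∷ _ = u , ∈-tabulateˢ⁻ (adj? v) (∈-elements⁻ (subst (u ∈_) (sym eq) (here refl)))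

  max-degree-attained : ∀ {d} → maxDegree G ≡ suc d → ∃[ v ] suc d ≤ degree G v
  max-degree-attained {d} Δ≡ with Any.any? (λ v → suc d ≤? degree G v) (allFin n)
  ... | yes any = let v , _ , d≤ = find any in v , d≤
  ... | no none = contradiction (subst (_≤ d) Δ≡ (max≤v⁺ {⊥ = 0} z≤n
                    (All.map⁺ (All.map (≤-pred ∘ ≰⇒>) (All.¬Any⇒All¬ (allFin n) none))))) (n≮n d)

-- A vertex of degree 3 lies on `p`, which is therefore not empty, and it has an edge, so every
-- decomposition has width at least 1.
caterpillar-pathwidth : ∀ n (F : Graph n) → Caterpillar F → maxDegree F ≡ 3 → HasPathwidth F 1
caterpillar-pathwidth n F (((_ , conn) , forest) , p , path , branch∈p) Δ≡3
  with max-degree-attained F Δ≡3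
... | z , 3≤d with degree≥1⇒nbr F (≤-trans (s≤s z≤n) 3≤d)
...   | u , zu = (D , ≤-antisym (width≤1 F conn forest path branch∈p z∈p) (1≤width F zu D)) , 1≤width F zu
  where
  z∈p : z ∈ p
  z∈p = branch∈p z (≤-trans (n≤1+n 2) 3≤d)
  D : PathDecomposition F
  D = intervals F conn forest path branch∈p z∈p

-- Acyclicity from unique lower neighbours

module _ (G : Graph n) where
  open Graph G renaming (sym to adj-sym)

  private
    _<ᶠ_ : Fin n → Fin n → Set
    u <ᶠ v = toℕ u < toℕ v

  Descends : Fin n → List (Fin n) → Set
  Descends x ys = ∃[ y ] (y ∈ ys × Adj x y × y <ᶠ x)

  module _ (lower! : ∀ {u v x} → Adj u x → Adj v x → u <ᶠ x → v <ᶠ x → u ≡ v) where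

    private
      compare : ∀ {u v} → u ≢ v → u <ᶠ v ⊎ v <ᶠ u
      compare {u} {v} u≢v with <-cmp (toℕ u) (toℕ v)
      ... | tri< u<v _ _ = inj₁ u<v
      ... | tri≈ _ u≡v _ = contradiction (toℕ-injective u≡v) u≢v
      ... | tri> _ _ v<u = inj₂ v<u

    -- Once a path ascends it keeps ascending: a vertex after which it descended again
    -- would have two lower neighbours.
    path-shape : ∀ {x w} zs → IsPath G (x ∷ zs ∷ʳ w) →
      (w <ᶠ x × Descends x (zs ∷ʳ w))
      ⊎ ((∃[ w′ ] (w′ ∈ x ∷ zs × Adj w′ w × w′ <ᶠ w)) × (Descends x (zs ∷ʳ w) ⊎ x <ᶠ w))
    path-shape {x} {w} [] (xw ∷ [-] , (x≢w ∷ []) ∷ _) with compare x≢w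
    ... | inj₁ x<w = inj₂ ((x , here refl , xw , x<w) , inj₂ x<w)
    ... | inj₂ w<x = inj₁ (w<x , w , here refl , xw , w<x)
    path-shape {x} {w} (y ∷ ys) (xy ∷ l , (x≢y ∷ x∉) ∷ u) with compare x≢y | path-shape ys (l , u)
    ... | inj₂ y<x | inj₁ (w<y , _) = inj₁ (<-trans w<y y<x , y , here refl , xy , y<x)
    ... | inj₂ y<x | inj₂ ((w′ , w′∈ , below) , _) =
      inj₂ ((w′ , there w′∈ , below) , inj₁ (y , here refl , xy , y<x))
    ... | inj₁ x<y | inj₁ (_ , y′ , y′∈ , yy′ , y′<y) =
      contradiction (lower! xy (adj-sym yy′) x<y y′<y) (All.lookup x∉ y′∈)
    ... | inj₁ x<y | inj₂ (_ , inj₁ (y′ , y′∈ , yy′ , y′<y)) =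
      contradiction (lower! xy (adj-sym yy′) x<y y′<y) (All.lookup x∉ y′∈)
    ... | inj₁ x<y | inj₂ ((w′ , w′∈ , below) , inj₂ y<w) =
      inj₂ ((w′ , there w′∈ , below) , inj₂ (<-trans x<y y<w))

    -- Comparing `u` with its two neighbours on the cycle, every case gives `u`, `v` or `w` two
    -- distinct lower neighbours, except for the cyclic order u < v < w < u.
    unique-lower⇒forest : Forest G
    unique-lower⇒forest record { vs = [] ; vs≢[] = vs≢[] } = vs≢[] refl
    unique-lower⇒forest record
      { u = u ; w = w ; vs = v ∷ vs ; isPath = uv ∷ l , (u≢v ∷ u∉) ∷ uniq@(v∉ ∷ _) ; closed = wu }
      = cases (compare u≢v) (compare u≢w) (path-shape vs (l , uniq))
      where
      u≢w : u ≢ w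
      u≢w = All.lookup u∉ (∈-++⁺ʳ vs (here refl))
      two-below-u : v <ᶠ u → w <ᶠ u → ⊥
      two-below-u v<u w<u = All.lookup v∉ (∈-++⁺ʳ vs (here refl)) (lower! (adj-sym uv) wu v<u w<u)
      two-below-v : u <ᶠ v → Descends v (vs ∷ʳ w) → ⊥
      two-below-v u<v (y , y∈ , vy , y<v) = All.lookup u∉ y∈ (lower! uv (adj-sym vy) u<v y<v)
      cases : u <ᶠ v ⊎ v <ᶠ u → u <ᶠ w ⊎ w <ᶠ u →
        (w <ᶠ v × Descends v (vs ∷ʳ w))
        ⊎ ((∃[ w′ ] (w′ ∈ v ∷ vs × Adj w′ w × w′ <ᶠ w)) × (Descends v (vs ∷ʳ w) ⊎ v <ᶠ w)) → ⊥
      cases (inj₁ u<v) _          (inj₁ (_ , down))     = two-below-v u<v down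
      cases (inj₂ v<u) _          (inj₁ (w<v , _))      = two-below-u v<u (<-trans w<v v<u)
      cases _          (inj₁ u<w) (inj₂ ((w′ , w′∈ , w′w , w′<w) , _)) =
        All.lookup (u≢v ∷ u∉) (∈-++⁺ˡ w′∈) (lower! (adj-sym wu) w′w u<w w′<w)
      cases (inj₂ v<u) (inj₂ w<u) (inj₂ _)               = two-below-u v<u w<u
      cases (inj₁ u<v) (inj₂ w<u) (inj₂ (_ , inj₁ down)) = two-below-v u<v down
      cases (inj₁ u<v) (inj₂ w<u) (inj₂ (_ , inj₂ v<w))  = <-irrefl refl (<-trans u<v (<-trans v<w w<u))

-- Combs as caterpillars of maximum degree 3

-- The comb: the even numbers form a path, and each odd number 2i + 1 hangs off 2i.
-- Adjacency is invariant under even translations by computation.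
edge : ℕ → ℕ → Bool
edge 0             0                   = false
edge 0             1                   = true
edge 0             2                   = true
edge 0             (suc (suc (suc _))) = false
edge 1             _                   = false
edge (suc (suc _)) 0                   = false
edge (suc (suc _)) 1                   = false
edge (suc (suc i)) (suc (suc j))       = edge i j

-- The lower neighbour in the comb. The root 0 has none; its value is a default.
parent : ℕ → ℕ
parent 0                   = 0
parent 1                   = 0
parent 2                   = 0
parent (suc (suc (suc i))) = suc (suc (parent (suc i)))

edge⇒< : ∀ i j → T (edge i j) → i < j
edge⇒< 0             1             _ = s≤s z≤n
edge⇒< 0             2             _ = s≤s z≤n
edge⇒< (suc (suc i)) (suc (suc j)) e = s≤s (s≤s (edge⇒< i j e))

edge⇒parent : ∀ i j → T (edge i j) → i ≡ parent j
edge⇒parent 0             1                   _ = refl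
edge⇒parent 0             2                   _ = refl
edge⇒parent (suc (suc i)) (suc (suc (suc j))) e = cong (2 +_) (edge⇒parent i (suc j) e)
-- This edge reduces to one from `i` to 0, but `edge` only points upwards.
edge⇒parent (suc (suc i)) 2 e with () ← edge⇒< i 0 e

edge⇒child : ∀ i j → T (edge i j) → j ∈ suc i ∷ suc (suc i) ∷ []
edge⇒child 0             1             _ = here refl
edge⇒child 0             2             _ = there (here refl)
edge⇒child (suc (suc i)) (suc (suc j)) e with edge⇒child i j e
... | here refl         = here refl
... | there (here refl) = there (here refl)

edge-irrefl : ∀ i → ¬ T (edge i i ∨ edge i i)
edge-irrefl (suc (suc i)) e = edge-irrefl i e

comb : ∀ n → Graph n
comb n = record
  { Adj    = λ u v → T (edge (toℕ u) (toℕ v) ∨ edge (toℕ v) (toℕ u))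
  ; adj?   = λ _ _ → T? _
  ; sym    = λ {u} {v} → subst T (∨-comm (edge (toℕ u) (toℕ v)) _)
  ; irrefl = λ { {u} refl → edge-irrefl (toℕ u) }
  }

T-∨⁻ : ∀ a {b} → T (a ∨ b) → T a ⊎ T b
T-∨⁻ true  _ = inj₁ _
T-∨⁻ false t = inj₂ t

module _ {n : ℕ} where
  open Graph (comb n) using (Adj)

  adj-below : ∀ {u v} → Adj u v → toℕ u < toℕ v → T (edge (toℕ u) (toℕ v))
  adj-below {u} {v} uv u<v with T-∨⁻ (edge (toℕ u) (toℕ v)) uv
  ... | inj₁ e = e
  ... | inj₂ e = contradiction u<v (<-asym (edge⇒< (toℕ v) (toℕ u) e))

  comb-forest : Forest (comb n)
  comb-forest = unique-lower⇒forest (comb n) λ {u} {v} {x} ux vx u<x v<x → toℕ-injective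
    (trans (edge⇒parent (toℕ u) (toℕ x) (adj-below {u} {x} ux u<x))
      (sym (edge⇒parent (toℕ v) (toℕ x) (adj-below {v} {x} vx v<x))))

  -- Candidates are natural numbers, so `xs` may contain values that are not vertices, such as
  -- children beyond the end of the comb.
  degree≤ : ∀ v (xs : List ℕ) → (∀ {u} → Adj v u → toℕ u ∈ xs) → degree (comb n) v ≤ length xs
  degree≤ v xs nbr∈xs = begin
    degree (comb n) v      ≡⟨ length-elements (N⟨_⟩ (comb n) v) ⟨
    length vs              ≡⟨ length-map toℕ vs ⟨
    length (map toℕ vs)    ≤⟨ ⊆⇒length≤ (Unique.map⁺ toℕ-injective (elements-unique _)) vs⊆xs ⟩
    length xs              ∎
    where
    open ≤-Reasoning
    vs = elements (N⟨_⟩ (comb n) v)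
    vs⊆xs : ∀ {i} → i ∈ map toℕ vs → i ∈ xs
    vs⊆xs i∈ with ∈-map⁻ toℕ i∈
    ... | u , u∈vs , refl = nbr∈xs (∈-tabulateˢ⁻ (Graph.adj? (comb n) v) (∈-elements⁻ u∈vs))

  degree≥ : ∀ v {us} → Unique us → All (Adj v) us → length us ≤ degree (comb n) v
  degree≥ v unique adj = subst (_ ≤_) (length-elements (N⟨_⟩ (comb n) v)) (⊆⇒length≤ unique λ u∈ →
    ∈-elements⁺ (∈-tabulateˢ⁺ (Graph.adj? (comb n) v) (All.lookup adj u∈)))

  degree≤3 : ∀ v → degree (comb n) v ≤ 3
  degree≤3 v = degree≤ v (parent (toℕ v) ∷ suc (toℕ v) ∷ suc (suc (toℕ v)) ∷ []) nbr
    where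
    nbr : ∀ {u} → Adj v u → toℕ u ∈ parent (toℕ v) ∷ suc (toℕ v) ∷ suc (suc (toℕ v)) ∷ []
    nbr {u} vu with T-∨⁻ (edge (toℕ v) (toℕ u)) vu
    ... | inj₁ e = there (edge⇒child (toℕ v) (toℕ u) e)
    ... | inj₂ e = here (edge⇒parent (toℕ u) (toℕ v) e)

  childless⇒degree≤1 : ∀ v → (∀ j → ¬ T (edge (toℕ v) j)) → degree (comb n) v ≤ 1
  childless⇒degree≤1 v childless = degree≤ v (parent (toℕ v) ∷ []) nbr
    where
    nbr : ∀ {u} → Adj v u → toℕ u ∈ parent (toℕ v) ∷ []
    nbr {u} vu with T-∨⁻ (edge (toℕ v) (toℕ u)) vu
    ... | inj₁ e = contradiction e (childless (toℕ u))
    ... | inj₂ e = here (edge⇒parent (toℕ u) (toℕ v) e)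

-- Translating the walk of `v` by 2 gives one that ends at 2, a neighbour of 0.
comb-to-root : ∀ n (v : Fin (suc n)) → Star (Graph.Adj (comb (suc n))) v zero
comb-to-root n zero = ε
comb-to-root (suc n) (suc zero) = _ ◅ ε
comb-to-root (suc (suc n)) (suc (suc v)) = gmap (2 ↑ʳ_) (λ e → e) (comb-to-root n v) ◅◅ (_ ◅ ε)

comb-connected : ∀ n → Connected (comb (suc n))
comb-connected n = zero , λ u v →
  comb-to-root n u ◅◅ reverse (λ {u} {v} → Graph.sym (comb (suc n)) {u} {v}) (comb-to-root n v)

spine : ∀ n → List (Fin n)
spine 0             = []
spine 1             = zero ∷ []
spine (suc (suc n)) = zero ∷ map (2 ↑ʳ_) (spine n)

spine-path : ∀ n → IsPath (comb n) (spine n)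
spine-path n = linked n , unique n
  where
  linked : ∀ n → Linked (Graph.Adj (comb n)) (spine n)
  linked 0 = []
  linked 1 = [-]
  linked 2 = [-]
  linked 3 = _ ∷ [-]
  linked (suc (suc (suc (suc n)))) = _ ∷ Linked.map⁺ (linked (suc (suc n)))
  unique : ∀ n → Unique (spine n)
  unique 0 = []
  unique 1 = [] ∷ []
  unique (suc (suc n)) = All.map⁺ (All.tabulate λ _ ()) ∷ Unique.map⁺ (λ { refl → refl }) (unique n)

-- The alternatives are even and odd vertices. A childless vertex has at most its parent as
-- neighbour.
spine-or-childless : ∀ {n} (v : Fin n) → v ∈ spine n ⊎ (∀ j → ¬ T (edge (toℕ v) j))
spine-or-childless {suc zero}    zero          = inj₁ (here refl)
spine-or-childless {suc (suc n)} zero          = inj₁ (here refl)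
spine-or-childless {suc (suc n)} (suc zero)    = inj₂ λ _ ()
spine-or-childless {suc (suc n)} (suc (suc v)) with spine-or-childless v
... | inj₁ v∈        = inj₁ (there (∈-map⁺ (2 ↑ʳ_) v∈))
... | inj₂ childless = inj₂ λ { (suc (suc j)) → childless j }

comb-caterpillar : ∀ n → 1 ≤ n → Caterpillar (comb n)
comb-caterpillar n@(suc m) _ = (comb-connected m , comb-forest) , spine n , spine-path n , branch∈spine
  where
  branch∈spine : ∀ v → 2 ≤ degree (comb n) v → v ∈ spine n
  branch∈spine v 2≤d with spine-or-childless v
  ... | inj₁ v∈        = v∈
  ... | inj₂ childless = contradiction (childless⇒degree≤1 v childless) (<⇒≱ 2≤d)

degree≤maxDegree : ∀ (G : Graph n) v → degree G v ≤ maxDegree G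
degree≤maxDegree {n} G v = All.lookup (xs≤max 0 (map (degree G) (allFin n))) (∈-map⁺ (degree G) (∈-allFin v))

maxDegree≤ : ∀ (G : Graph n) {d} → (∀ v → degree G v ≤ d) → maxDegree G ≤ d
maxDegree≤ G degree≤d = max≤v⁺ {⊥ = 0} z≤n (All.map⁺ (All.tabulate⁺ degree≤d))

-- Vertex 2 has the neighbours 0, 3 and 4, all present once `n` is at least 5.
comb-maxDegree : ∀ n → 5 ≤ n → maxDegree (comb n) ≡ 3
comb-maxDegree n@(suc (suc (suc (suc (suc _))))) (s≤s (s≤s (s≤s (s≤s (s≤s _))))) =
  ≤-antisym (maxDegree≤ (comb n) degree≤3) (≤-trans 3≤degree (degree≤maxDegree (comb n) 2F))
  where
  3≤degree : 3 ≤ degree (comb n) 2F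
  3≤degree = degree≥ {n} 2F {0F ∷ 3F ∷ 4F ∷ []}
    (((λ ()) ∷ (λ ()) ∷ []) ∷ ((λ ()) ∷ []) ∷ [] ∷ []) (_ ∷ _ ∷ _ ∷ [])

-- Sets in the comb that attain the bound

-- On the spine, S is the word (SSSx)^q followed by Sxxx, SxSx or SSSx (r = 0, 1, 2).
-- The first letter, always S, is split off so that each block sees the S that follows it.
witness-tail : ∀ q → Fin 3 → Subset (7 + q * 8)
witness-tail zero 0F = Sub.⊥
witness-tail zero 1F = outside ∷ outside ∷ outside ∷ inside ∷ Sub.⊥
witness-tail zero 2F = outside ∷ inside ∷ outside ∷ inside ∷ Sub.⊥
witness-tail (suc q) r =
  outside ∷ inside ∷ outside ∷ inside ∷ outside ∷ outside ∷ outside ∷ inside ∷ witness-tail q r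

witness : ∀ q → Fin 3 → Subset (suc q * 8)
witness q r = inside ∷ witness-tail q r

∣witness∣ : ∀ q r → ∣ witness q r ∣ ≡ suc (toℕ r + q * 3)
∣witness∣ q r = cong suc (tail q r)
  where
  tail : ∀ q r → ∣ witness-tail q r ∣ ≡ toℕ r + q * 3
  tail zero 0F = refl
  tail zero 1F = refl
  tail zero 2F = refl
  tail (suc q) r = trans (cong (3 +_) (tail q r)) (lemma (toℕ r) (q * 3))
    where
    lemma : ∀ a b → 3 + (a + b) ≡ a + (3 + b)
    lemma = solve-∀

trace : ∀ q r → Fin (suc q * 8) → Subset (suc q * 8)
trace q r = class (comb (suc q * 8)) (witness q r)

-- The only possible neighbour of a shifted vertex in the first block is 6, the x of that block,
-- which is not in S.
trace-shift : ∀ q r u → trace (suc q) r (8 ↑ʳ u) ≡ Vec.replicate 8 outside Vec.++ trace q r u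
trace-shift q r u = cong (λ b → Vec.replicate 6 outside Vec.++ b ∷ outside ∷ trace q r u) (∧-zeroʳ _)

-- The floors of 7/3, 14/3 and 21/3.
base : Fin 3 → ℕ
base 0F = 2
base 1F = 4
base 2F = 7

-- Each further block adds its four path vertices and the pendants of its three S-vertices. Their
-- traces are nonzero on the first eight coordinates, where all shifted traces vanish.
distinct-traces : ∀ q r → ∃[ us ] (Unique (map (trace q r) us) × length us ≡ base r + q * 7)
-- In each base case the last vertex listed contributes the empty trace.
distinct-traces zero 0F = us , from-yes (unique? _≟ˢ_ (map (trace 0 0F) us)) , refl
  where us = 1F ∷ 3F ∷ []
distinct-traces zero 1F = us , from-yes (unique? _≟ˢ_ (map (trace 0 1F) us)) , refl
  where us = 1F ∷ 2F ∷ 5F ∷ 7F ∷ []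
distinct-traces zero 2F = us , from-yes (unique? _≟ˢ_ (map (trace 0 2F) us)) , refl
  where us = 0F ∷ 1F ∷ 2F ∷ 3F ∷ 4F ∷ 5F ∷ 7F ∷ []
distinct-traces (suc q) r with distinct-traces q r
... | us , unique , len = block ++ map (8 ↑ʳ_) us , all-unique
  , trans (cong (7 +_) (trans (length-map (8 ↑ʳ_) us) len)) (lemma (base r) (q * 7))
  where
  block : List (Fin (suc (suc q) * 8))
  block = 0F ∷ 1F ∷ 2F ∷ 3F ∷ 4F ∷ 5F ∷ 6F ∷ []
  block-unique : Unique (map (trace (suc q) r) block)
  -- Nine coordinates are known although `q` is a variable. The ninth, the first S of the next
  -- block, separates the trace of 6 from that of 5.
  block-unique = Unique.map⁻ {f = Vec.take 9}
    (from-yes (unique? _≟ˢ_ (map (Vec.take 9) (map (trace (suc q) r) block))))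
  all-unique : Unique (map (trace (suc q) r) (block ++ map (8 ↑ʳ_) us))
  all-unique = subst Unique (sym (map-++ (trace (suc q) r) block (map (8 ↑ʳ_) us)))
    (Unique.++⁺ block-unique shifted-unique disjoint)
    where
    shifted≡ : map (trace (suc q) r) (map (8 ↑ʳ_) us) ≡ map (Vec.replicate 8 outside Vec.++_) (map (trace q r) us)
    shifted≡ = trans (sym (map-∘ us)) (trans (map-cong (trace-shift q r) us) (map-∘ us))
    shifted-unique : Unique (map (trace (suc q) r) (map (8 ↑ʳ_) us))
    shifted-unique = subst Unique (sym shifted≡)
      (Unique.map⁺ (++-injectiveʳ (Vec.replicate 8 outside) (Vec.replicate 8 outside)) unique)
    block-nonzero : All (λ T → Vec.take 8 T ≢ Vec.replicate 8 outside) (map (trace (suc q) r) block)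
    block-nonzero = (λ ()) ∷ (λ ()) ∷ (λ ()) ∷ (λ ()) ∷ (λ ()) ∷ (λ ()) ∷ (λ ()) ∷ []
    disjoint : ∀ {T} → T ∈ map (trace (suc q) r) block × T ∈ map (trace (suc q) r) (map (8 ↑ʳ_) us) → ⊥
    disjoint (T∈block , T∈shifted) with ∈-map⁻ (Vec.replicate 8 outside Vec.++_) (subst (_ ∈_) shifted≡ T∈shifted)
    ... | _ , _ , refl = All.lookup block-nonzero T∈block refl
  lemma : ∀ a b → 7 + (a + b) ≡ a + (7 + b)
  lemma = solve-∀

∈-subsets : ∀ (S : Subset n) → S ∈ subsets n
∈-subsets []                    = here refl
∈-subsets (inside ∷ S)          = ∈-++⁺ˡ (∈-map⁺ _ (∈-subsets S))
∈-subsets {suc n} (outside ∷ S) = ∈-++⁺ʳ (map (inside ∷_) (subsets n)) (∈-map⁺ _ (∈-subsets S))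

distinct⇒≤nc : ∀ (G : Graph n) (S : Subset n) us → Unique (map (class G S) us) → length us ≤ nc G ∣ S ∣
distinct⇒≤nc {n} G S us unique = begin
  length us                ≡⟨ length-map (class G S) us ⟨
  length (map (class G S) us) ≤⟨ ⊆⇒length≤ unique classes⊆ ⟩
  ncSet G S                ≤⟨ All.lookup (xs≤max 0 _)
                                (∈-map⁺ (ncSet G) (∈-filter⁺ (λ T → ∣ T ∣ ≟ ∣ S ∣) (∈-subsets S) refl)) ⟩
  nc G ∣ S ∣               ∎
  where
  open ≤-Reasoning
  classes⊆ : ∀ {T} → T ∈ map (class G S) us → T ∈ deduplicate _≟ˢ_ (map (class G S) (allFin n))
  classes⊆ T∈ with ∈-map⁻ (class G S) T∈
  ... | u , _ , refl = ∈-deduplicate⁺ _≟ˢ_ (∈-map⁺ (class G S) (∈-allFin u))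

floor≤base : ∀ q r → 7 * suc (toℕ r + q * 3) / 3 ≤ base r + q * 7
floor≤base q r = ≤-pred (m<n*o⇒m/o<n (bound r))
  where
  bound : ∀ r → 7 * suc (toℕ r + q * 3) < suc (base r + q * 7) * 3
  bound 0F = ≤-trans (m≤m+n _ 1) (≤-reflexive (lemma q))
    where
    lemma : ∀ q → suc (7 * suc (q * 3)) + 1 ≡ suc (2 + q * 7) * 3
    lemma = solve-∀
  bound 1F = ≤-reflexive (lemma q)
    where
    lemma : ∀ q → suc (7 * suc (1 + q * 3)) ≡ suc (4 + q * 7) * 3
    lemma = solve-∀
  bound 2F = ≤-trans (m≤m+n _ 2) (≤-reflexive (lemma q))
    where
    lemma : ∀ q → suc (7 * suc (2 + q * 3)) + 2 ≡ suc (7 + q * 7) * 3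
    lemma = solve-∀

comb-nc : ∀ q r → nc (comb (suc q * 8)) (suc (toℕ r + q * 3)) ≡ 7 * suc (toℕ r + q * 3) / 3
comb-nc q r = ≤-antisym (nc-bound _ (comb (suc q * 8)) _ comb-forest (s≤s z≤n)) lower
  where
  lower : 7 * suc (toℕ r + q * 3) / 3 ≤ nc (comb (suc q * 8)) (suc (toℕ r + q * 3))
  lower with distinct-traces q r
  ... | us , unique , len = begin
    7 * suc (toℕ r + q * 3) / 3                     ≤⟨ floor≤base q r ⟩
    base r + q * 7                                  ≡⟨ len ⟨
    length us                                       ≤⟨ distinct⇒≤nc (comb (suc q * 8)) (witness q r) us unique ⟩
    nc (comb (suc q * 8)) ∣ witness q r ∣           ≡⟨ cong (nc (comb (suc q * 8))) (∣witness∣ q r) ⟩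
    nc (comb (suc q * 8)) (suc (toℕ r + q * 3))     ∎
    where open ≤-Reasoning

Tight : ℕ → Set₁
Tight k = ∃[ n ] Σ[ F ∈ Graph n ] (3 ≤ n × Caterpillar F × maxDegree F ≡ 3 × nc F k ≡ (7 * k) / 3)

comb-tight : ∀ q (r : Fin 3) → Tight (suc (toℕ r + q * 3))
comb-tight q r = suc q * 8 , comb (suc q * 8) , s≤s (s≤s (s≤s z≤n)) , comb-caterpillar (suc q * 8) (s≤s z≤n)
  , comb-maxDegree (suc q * 8) (s≤s (s≤s (s≤s (s≤s (s≤s z≤n))))) , comb-nc q r

-- Dividing k - 1 rather than k by 3 leaves between one and three S-vertices for the final block.
tight : ∀ k → 1 ≤ k → Tight k
tight (suc k) _ = from-divMod (k divMod 3)
  where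
  from-divMod : DivMod k 3 → Tight (suc k)
  from-divMod (result q r k≡) = subst (Tight ∘ suc) (sym k≡) (comb-tight q r)

theorem2 : (∀ (n : ℕ) (F : Graph n) (k : ℕ) → Forest F → 3 ≤ n → 1 ≤ k → nc F k ≤ (7 * k) / 3)
    × (∀ (k : ℕ) → 1 ≤ k →
    ∃[ n ] Σ[ F ∈ Graph n ]
    (3 ≤ n × Caterpillar F × maxDegree F ≡ 3 × nc F k ≡ (7 * k) / 3))
    × (∀ (n : ℕ) (F : Graph n) → Caterpillar F → maxDegree F ≡ 3 → HasPathwidth F 1)
theorem2 = (λ n F k forest _ → nc-bound n F k forest) , tight , caterpillar-pathwidth
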